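{- Let $t \ge 1$ be an integer and let $1 \le i \le t$. For any integer $s$ with $2^{t+1} - 2^{(t+1)-i} < s < 2^{t+1} - 2^{(t+1)-(i+1)}$, there does not exist any $t$-$(v,t+1)$ Latin trade of volume $s$ (for any positive integer $v$).
   Context: Let $t \le k$ and $v$ be positive integers, $V = \{1,\dots,v\}$, and let $V^k$ be the set of ordered $k$-tuples of elements of $V$. For a $t$-subset $I = \{i_1 < \cdots < i_t\}$ of $\{1,\dots,k\}$ and $(u_1,\dots,u_t) \in V^t$, the tuple $(x_1,\dots,x_k) \in V^k$ is said to contain $(u_1,\dots,u_t)_I$ if $x_{i_j} = u_j$ for all $j = 1,\dots,t$. A $t$-$(v,k)$ Latin trade of volume $s$ is a pair $T = (T_1,T_2)$ of disjoint collections (finite multisets, i.e. repeated elements are allowed; disjoint means no tuple occurs in both), each consisting of $s$ elements of $V^k$ counted with multiplicity, such that for each $t$-subset $I \subseteq \{1,\dots,k\}$ and each $(u_1,\dots,u_t) \in V^t$, the number of elements (with multiplicity) of $T_1$ containing $(u_1,\dots,u_t)_I$ equals the number of elements of $T_2$ containing $(u_1,\dots,u_t)_I$. -}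

module Defs where

open import Data.Fin using (Fin; _<_)
open import Data.Fin.Properties using (all?; _≟_)
open import Data.List using (List; length; filter)
open import Data.List.Relation.Binary.Disjoint.Propositional using (Disjoint)
open import Data.Nat using (ℕ)
open import Data.Vec using (Vec; lookup)
open import Relation.Binary.PropositionalEquality using (_≡_)
open import Relation.Nullary using (Dec)

-- V = {1,…,v} is represented by Fin v, and V^k by Tuple v k.
Tuple : ℕ → ℕ → Set
Tuple v k = Vec (Fin v) k

-- A t-subset I = {i₁ < ⋯ < i_t} of the k positions is represented by its
-- unique increasing enumeration j ↦ i_j.
record Positions (t k : ℕ) : Set where
  field
    position   : Fin t → Fin k
    increasing : ∀ {a b} → a < b → position a < position b

open Positions public

Contains : ∀ {t k v} → Positions t k → Tuple v t → Tuple v k → Set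
Contains I u x = ∀ j → lookup x (position I j) ≡ lookup u j

contains? : ∀ {t k v} (I : Positions t k) (u : Tuple v t) (x : Tuple v k) →
            Dec (Contains I u x)
contains? I u x = all? λ j → lookup x (position I j) ≟ lookup u j

-- A finite multiset is given by a list of its elements; every notion below
-- is invariant under reordering of the list.
countContaining : ∀ {t k v} → Positions t k → Tuple v t → List (Tuple v k) → ℕ
countContaining I u T = length (filter (contains? I u) T)

record LatinTrade (t k v s : ℕ) : Set where
  field
    T₁ T₂    : List (Tuple v k)
    disjoint : Disjoint T₁ T₂
    volume₁  : length T₁ ≡ s
    volume₂  : length T₂ ≡ s
    balanced : (I : Positions t k) (u : Tuple v t) →
               countContaining I u T₁ ≡ countContaining I u T₂

{-# OPTIONS --safe #-}

-- Record a trade by f = (multiplicity in T₁) − (multiplicity in T₂). All line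
-- sums of f vanish, and since T₁ and T₂ are disjoint its ℓ¹-norm is 2s. By
-- induction on k, a function V^k → ℤ with vanishing line sums has norm
-- 2^(k+1) − 2^m for some m as soon as the norm is below 2^(k+1): cut f into
-- layers along the first coordinate. Nonzero layers have norm at least 2^(k-1),
-- so at most three of them are nonzero. Two layers are opposite to each other,
-- and induction applies. With three, the triangle inequality makes each norm
-- less than 2^k, hence of the form 2^k − 2^m, and the bound on the total forces
-- two of them to equal 2^(k-1), which leaves 2^k + (2^k − 2^m) for the total.
module Submission where

open import Defs
import Algebra.Properties.CommutativeMonoid.Sum
open import Data.Bool using (if_then_else_)
open import Data.Fin as Fin using (Fin; zero; suc; punchIn)
import Data.Fin.Properties as Fin
open import Data.Integer as ℤ using (ℤ; 0ℤ; ∣_∣; _⊖_)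
import Data.Integer.Properties as ℤ
import Data.Integer.Tactic.RingSolver as ℤ-Solver
open import Data.List using (List; []; _∷_; length; filter; map)
open import Data.List.Membership.Propositional using (_∈_)
open import Data.List.Relation.Unary.All using (All; []; _∷_)
open import Data.List.Relation.Unary.Any using (here; there)
open import Data.Nat using (ℕ; zero; suc; _+_; _*_; _∸_; _^_; _≤_; _<_; _<?_; s≤s; z≤n; s≤s⁻¹)
import Data.Nat.ListAction as ListAction
open import Data.Nat.Properties
open import Data.Nat.Tactic.RingSolver using (solve-∀)
open import Data.Product using (∃-syntax; _×_; _,_; proj₁; proj₂)
open import Data.Sum using (_⊎_; inj₁; inj₂)
open import Data.Unit using (⊤; tt)
open import Data.Vec using ([]; _∷_; lookup; insertAt)
open import Data.Vec.Properties as Vec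
  using (≡-dec; insertAt-lookup; insertAt-punchIn; tabulate∘lookup; tabulate-cong)
open import Function using (_∘_)
open import Relation.Binary.PropositionalEquality
open import Relation.Nullary using (Dec; yes; no; does; ¬_; contradiction)
open import Relation.Nullary.Decidable using (dec-true; dec-false)
open import Relation.Unary using (Decidable)

private
  module ℕΣ = Algebra.Properties.CommutativeMonoid.Sum +-0-commutativeMonoid
  module ℤΣ = Algebra.Properties.CommutativeMonoid.Sum ℤ.+-0-commutativeMonoid

  variable
    k t v : ℕ

-- Sums over V and over V^k

sum-zero : (g : Fin v → ℕ) → (∀ a → g a ≡ 0) → ℕΣ.sum g ≡ 0
sum-zero {v} g g≡0 = trans (ℕΣ.sum-cong-≗ g≡0) (ℕΣ.sum-replicate-zero v)

sum-single : (g : Fin v → ℕ) (b : Fin v) → (∀ a → a ≢ b → g a ≡ 0) → ℕΣ.sum g ≡ g b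
sum-single {suc v} g b off = begin
  ℕΣ.sum g                          ≡⟨ ℕΣ.sum-remove g ⟩
  g b + ℕΣ.sum (g ∘ punchIn b)      ≡⟨ cong (g b +_) (sum-zero _ λ j → off _ (Fin.punchInᵢ≢i b j)) ⟩
  g b + 0                           ≡⟨ +-identityʳ _ ⟩
  g b                               ∎
  where open ≡-Reasoning

sum-mono : {g h : Fin v → ℕ} → (∀ a → g a ≤ h a) → ℕΣ.sum g ≤ ℕΣ.sum h
sum-mono {zero}  g≤h = z≤n
sum-mono {suc v} g≤h = +-mono-≤ (g≤h zero) (sum-mono (g≤h ∘ suc))

⊖-+-⊖ : ∀ m n o p → (m ⊖ n) ℤ.+ (o ⊖ p) ≡ (m + o) ⊖ (n + p)
⊖-+-⊖ m n o p = begin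
  (m ⊖ n) ℤ.+ (o ⊖ p)                                  ≡⟨ cong₂ ℤ._+_ (ℤ.m-n≡m⊖n m n) (ℤ.m-n≡m⊖n o p) ⟨
  (ℤ.+ m ℤ.- ℤ.+ n) ℤ.+ (ℤ.+ o ℤ.- ℤ.+ p)              ≡⟨ interchange (ℤ.+ m) (ℤ.+ n) (ℤ.+ o) (ℤ.+ p) ⟩
  (ℤ.+ m ℤ.+ ℤ.+ o) ℤ.- (ℤ.+ n ℤ.+ ℤ.+ p)              ≡⟨ cong₂ ℤ._-_ (ℤ.pos-+ m o) (ℤ.pos-+ n p) ⟨
  ℤ.+ (m + o) ℤ.- ℤ.+ (n + p)                          ≡⟨ ℤ.m-n≡m⊖n (m + o) (n + p) ⟩
  (m + o) ⊖ (n + p)                                    ∎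
  where
  open ≡-Reasoning
  interchange : ∀ w x y z → (w ℤ.- x) ℤ.+ (y ℤ.- z) ≡ (w ℤ.+ y) ℤ.- (x ℤ.+ z)
  interchange = ℤ-Solver.solve-∀

sum-⊖ : (g h : Fin v → ℕ) → ℤΣ.sum (λ a → g a ⊖ h a) ≡ ℕΣ.sum g ⊖ ℕΣ.sum h
sum-⊖ {zero}  g h = refl
sum-⊖ {suc v} g h = trans (cong (ℤ._+_ (g zero ⊖ h zero)) (sum-⊖ (g ∘ suc) (h ∘ suc)))
                          (⊖-+-⊖ (g zero) (h zero) _ _)

total : (Tuple v k → ℕ) → ℕ
total {k = zero}  g = g []
total {k = suc k} g = ℕΣ.sum λ a → total λ x → g (a ∷ x)

total-cong : {g h : Tuple v k → ℕ} → (∀ x → g x ≡ h x) → total g ≡ total h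
total-cong {k = zero}  g≡h = g≡h []
total-cong {k = suc k} g≡h = ℕΣ.sum-cong-≗ λ a → total-cong λ x → g≡h (a ∷ x)

total-mono : {g h : Tuple v k → ℕ} → (∀ x → g x ≤ h x) → total g ≤ total h
total-mono {k = zero}  g≤h = g≤h []
total-mono {k = suc k} g≤h = sum-mono λ a → total-mono λ x → g≤h (a ∷ x)

total-+ : (g h : Tuple v k → ℕ) → total (λ x → g x + h x) ≡ total g + total h
total-+ {k = zero}  g h = refl
total-+ {k = suc k} g h =
  trans (ℕΣ.sum-cong-≗ λ a → total-+ (g ∘ (a ∷_)) (h ∘ (a ∷_)))
        (ℕΣ.∑-distrib-+ (λ a → total (g ∘ (a ∷_))) (λ a → total (h ∘ (a ∷_))))

total-zero : (g : Tuple v k → ℕ) → (∀ x → g x ≡ 0) → total g ≡ 0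
total-zero {k = zero}  g g≡0 = g≡0 []
total-zero {k = suc k} g g≡0 = sum-zero _ λ a → total-zero _ λ x → g≡0 (a ∷ x)

total-single : (g : Tuple v k → ℕ) (y : Tuple v k) → (∀ x → x ≢ y → g x ≡ 0) → total g ≡ g y
total-single g []      off = refl
total-single g (b ∷ y) off =
  trans (sum-single _ b λ a a≢b → total-zero (λ x → g (a ∷ x)) λ x → off (a ∷ x) (a≢b ∘ Vec.∷-injectiveˡ))
        (total-single _ y λ x x≢y → off (b ∷ x) (x≢y ∘ Vec.∷-injectiveʳ))

-- Functions with vanishing line sums

norm : (Tuple v k → ℤ) → ℕ
norm f = total λ x → ∣ f x ∣

-- The lines in direction d are the sets { insertAt u d a | a ∈ V }.
ZeroLineSums : (Tuple v k → ℤ) → Set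
ZeroLineSums {k = zero}  f = ⊤
ZeroLineSums {k = suc k} f = ∀ d u → ℤΣ.sum (λ a → f (insertAt u d a)) ≡ 0ℤ

-- A line within the layer over `a` is a line of the whole function in direction `suc d`, since
-- `insertAt (a ∷ u) (suc d) b` reduces to `a ∷ insertAt u d b`.
ZeroLineSums-layer : (f : Tuple v (suc k) → ℤ) → ZeroLineSums f →
                     ∀ a → ZeroLineSums λ x → f (a ∷ x)
ZeroLineSums-layer {k = zero}  f z a     = tt
ZeroLineSums-layer {k = suc k} f z a d u = z (suc d) (a ∷ u)

listSum : List (Tuple v k → ℤ) → Tuple v k → ℤ
listSum []       x = 0ℤ
listSum (f ∷ fs) x = f x ℤ.+ listSum fs x

norm≡0⇒≡0 : (f : Tuple v k → ℤ) → norm f ≡ 0 → ∀ x → f x ≡ 0ℤ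
norm≡0⇒≡0 f eq x = ℤ.∣i∣≡0⇒i≡0 (total≡0 (∣_∣ ∘ f) eq x)
  where
  sum≡0 : ∀ {v} (g : Fin v → ℕ) → ℕΣ.sum g ≡ 0 → ∀ a → g a ≡ 0
  sum≡0 g eq zero    = m+n≡0⇒m≡0 (g zero) eq
  sum≡0 g eq (suc a) = sum≡0 (g ∘ suc) (m+n≡0⇒n≡0 (g zero) eq) a
  total≡0 : ∀ {v k} (g : Tuple v k → ℕ) → total g ≡ 0 → ∀ x → g x ≡ 0
  total≡0 g eq []      = eq
  total≡0 g eq (a ∷ x) = total≡0 (g ∘ (a ∷_)) (sum≡0 _ eq a) x

-- Zero layers affect neither the pointwise sum nor the total norm. Dropping them leaves a list, so
-- that the induction step can split on the number of nonzero layers; `P` carries the induction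
-- hypothesis along.
nonzero-layers : ∀ {n} (P : (Tuple v k → ℤ) → Set) (g : Fin n → Tuple v k → ℤ) → (∀ a → P (g a)) →
  ∃[ fs ] All (λ f → P f × norm f ≢ 0) fs
        × (∀ x → ℤΣ.sum (λ a → g a x) ≡ listSum fs x)
        × ℕΣ.sum (λ a → norm (g a)) ≡ ListAction.sum (map norm fs)
nonzero-layers {n = zero}  P g Pg = [] , [] , (λ x → refl) , refl
nonzero-layers {n = suc n} P g Pg
  with fs , all , sums , norms ← nonzero-layers P (g ∘ suc) (Pg ∘ suc)
  with norm (g zero) ≟ 0
... | yes ≡0 = fs , all
             , (λ x → trans (cong₂ ℤ._+_ (norm≡0⇒≡0 (g zero) ≡0 x) (sums x)) (ℤ.+-identityˡ _))
             , cong₂ _+_ ≡0 norms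
... | no  ≢0 = g zero ∷ fs , (Pg zero , ≢0) ∷ all
             , (λ x → cong (ℤ._+_ (g zero x)) (sums x))
             , cong (norm (g zero) +_) norms

i+j≡0⇒∣i∣≡∣j∣ : ∀ i j → i ℤ.+ j ≡ 0ℤ → ∣ i ∣ ≡ ∣ j ∣
i+j≡0⇒∣i∣≡∣j∣ i j eq = begin
  ∣ i ∣        ≡⟨ cong ∣_∣ (ℤ.i-j≡0⇒i≡j i (ℤ.- j) (trans (cong (ℤ._+_ i) (ℤ.neg-involutive j)) eq)) ⟩
  ∣ ℤ.- j ∣    ≡⟨ ℤ.∣-i∣≡∣i∣ j ⟩
  ∣ j ∣        ∎
  where open ≡-Reasoning

norm-opposite : (f g : Tuple v k → ℤ) → (∀ x → f x ℤ.+ g x ≡ 0ℤ) → norm f ≡ norm g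
norm-opposite f g f+g≡0 = total-cong λ x → i+j≡0⇒∣i∣≡∣j∣ (f x) (g x) (f+g≡0 x)

norm-triangle : (f g h : Tuple v k → ℤ) → (∀ x → f x ℤ.+ (g x ℤ.+ h x) ≡ 0ℤ) →
                norm f ≤ norm g + norm h
norm-triangle f g h f+g+h≡0 = begin
  norm f                               ≡⟨ norm-opposite f (λ x → g x ℤ.+ h x) f+g+h≡0 ⟩
  norm (λ x → g x ℤ.+ h x)             ≤⟨ total-mono (λ x → ℤ.∣i+j∣≤∣i∣+∣j∣ (g x) (h x)) ⟩
  total (λ x → ∣ g x ∣ + ∣ h x ∣)      ≡⟨ total-+ (∣_∣ ∘ g) (∣_∣ ∘ h) ⟩
  norm g + norm h                      ∎
  where open ≤-Reasoning

-- The norm spectrum below 2^(k+1)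

2^-cancel-≤ : ∀ m n → 2 ^ m ≤ 2 ^ n → m ≤ n
2^-cancel-≤ m n le = ≮⇒≥ λ n<m → <⇒≱ (^-monoʳ-< 2 (s≤s (s≤s z≤n)) n<m) le

2^-cancel-< : ∀ m n → 2 ^ m < 2 ^ n → m < n
2^-cancel-< m n lt = ≰⇒> λ n≤m → <⇒≱ lt (^-monoʳ-≤ 2 n≤m)

2^-suc : ∀ k → 2 ^ suc k ≡ 2 ^ k + 2 ^ k
2^-suc k = cong (2 ^ k +_) (+-identityʳ _)

-- The admissible values are 0, 2^k, 2^k + 2^(k-1), ..., 2^(k+1) - 1, for m = k+1, k, k-1, ..., 0.
-- The bound on `n` is a premise, so that every layer satisfies the predicate, however large its
-- norm. The equation is additive to avoid truncated subtraction.
Spectrum : ℕ → ℕ → Set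
Spectrum k n = n < 2 ^ suc k → ∃[ m ] n + 2 ^ m ≡ 2 ^ suc k

-- As `n` is nonzero, m ≤ k. The exponent m = k gives 2^k, and any smaller one gives at least
-- 2^(k+1) - 2^(k-1), which is three halves of 2^k; doubling removes the fraction.
spectrum-dichotomy : ∀ k n → n ≢ 0 → n < 2 ^ suc k → Spectrum k n →
                     n ≡ 2 ^ k ⊎ 3 * 2 ^ k ≤ 2 * n
spectrum-dichotomy k n n≢0 n< spec with spec n<
... | m , eq with m ≟ k
...   | yes refl = inj₁ (+-cancelʳ-≡ (2 ^ k) n (2 ^ k) (trans eq (2^-suc k)))
...   | no m≢k = inj₂ (+-cancelʳ-≤ (2 * 2 ^ m) _ _ (begin
  3 * 2 ^ k + 2 * 2 ^ m    ≤⟨ +-monoʳ-≤ (3 * 2 ^ k) (^-monoʳ-≤ 2 m<k) ⟩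
  3 * 2 ^ k + 2 ^ k        ≡⟨ four (2 ^ k) ⟩
  2 * (2 ^ suc k)          ≡⟨ cong (2 *_) eq ⟨
  2 * (n + 2 ^ m)          ≡⟨ *-distribˡ-+ 2 n (2 ^ m) ⟩
  2 * n + 2 * 2 ^ m        ∎))
  where
  open ≤-Reasoning
  four : ∀ p → 3 * p + p ≡ 2 * (2 * p)
  four = solve-∀
  m≤k : m ≤ k
  m≤k = s≤s⁻¹ (2^-cancel-< m (suc k) (subst (2 ^ m <_) eq (m<n+m (2 ^ m) (n≢0⇒n>0 n≢0))))
  m<k : m < k
  m<k = ≤∧≢⇒< m≤k m≢k

2^≤nonzero-spectrum : ∀ k n → n ≢ 0 → Spectrum k n → 2 ^ k ≤ n
2^≤nonzero-spectrum k n n≢0 spec with n <? 2 ^ suc k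
... | no n≮ = ≤-trans (^-monoʳ-≤ 2 (n≤1+n k)) (≮⇒≥ n≮)
... | yes n< with spectrum-dichotomy k n n≢0 n< spec
...   | inj₁ n≡ = ≤-reflexive (sym n≡)
...   | inj₂ 3≤ = *-cancelˡ-≤ 2 (≤-trans (*-monoˡ-≤ (2 ^ k) (n≤1+n 2)) 3≤)

-- The two minimal norms add up to 2^(k+1), which is exactly the growth of the threshold, so the
-- exponent found for `c` serves the total as well.
spectrum-two-minimal : ∀ k a b c → a ≡ 2 ^ k → b ≡ 2 ^ k → c < 2 ^ suc k → Spectrum k c →
                       ∃[ m ] (a + b + c) + 2 ^ m ≡ 2 ^ suc (suc k)
spectrum-two-minimal k _ _ c refl refl c< spec with m , eq ← spec c< = m , (begin
  2 ^ k + 2 ^ k + c + 2 ^ m     ≡⟨ +-assoc (2 ^ k + 2 ^ k) c (2 ^ m) ⟩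
  2 ^ k + 2 ^ k + (c + 2 ^ m)   ≡⟨ cong₂ _+_ (sym (2^-suc k)) eq ⟩
  2 ^ suc k + 2 ^ suc k         ≡⟨ 2^-suc (suc k) ⟨
  2 ^ suc (suc k)               ∎)
  where open ≡-Reasoning

-- In units of `p` this is 3/2 + 3/2 + 1 = 4. With `p` = 2^k, two nonminimal layers and a third
-- nonzero one already reach the threshold 2^(k+2).
two-nonminimal-≤ : ∀ p a b c → 3 * p ≤ 2 * a → 3 * p ≤ 2 * b → p ≤ c → 2 * (2 * p) ≤ a + b + c
two-nonminimal-≤ p a b c 3p≤2a 3p≤2b p≤c = *-cancelˡ-≤ 2 (begin
  2 * (2 * (2 * p))            ≡⟨ eight p ⟩
  3 * p + 3 * p + 2 * p        ≤⟨ +-mono-≤ (+-mono-≤ 3p≤2a 3p≤2b) (*-monoʳ-≤ 2 p≤c) ⟩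
  2 * a + 2 * b + 2 * c        ≡⟨ distrib a b c ⟩
  2 * (a + b + c)              ∎)
  where
  open ≤-Reasoning
  eight : ∀ p → 2 * (2 * (2 * p)) ≡ 3 * p + 3 * p + 2 * p
  eight = solve-∀
  distrib : ∀ a b c → 2 * a + 2 * b + 2 * c ≡ 2 * (a + b + c)
  distrib = solve-∀

triangle⇒<half : ∀ a b c p → a ≤ b + c → a + b + c < 2 * p → a < p
triangle⇒<half a b c p a≤b+c lt = *-cancelˡ-< 2 a p (begin-strict
  2 * a          ≡⟨ cong (a +_) (+-identityʳ a) ⟩
  a + a          ≤⟨ +-monoʳ-≤ a a≤b+c ⟩
  a + (b + c)    ≡⟨ +-assoc a b c ⟨
  a + b + c      <⟨ lt ⟩
  2 * p          ∎)
  where open ≤-Reasoning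

-- Each norm is either minimal or at least three halves of the minimum, so two of the three fall
-- into the same class. Two minimal ones give the claim through the third, and two nonminimal ones
-- contradict the bound on the total.
spectrum-three : ∀ k a b c → a ≢ 0 → b ≢ 0 → c ≢ 0 →
  Spectrum k a → Spectrum k b → Spectrum k c →
  a ≤ b + c → b ≤ c + a → c ≤ a + b → Spectrum (suc k) (a + b + c)
spectrum-three k a b c a≢0 b≢0 c≢0 sa sb sc a≤ b≤ c≤ lt =
  cases (spectrum-dichotomy k a a≢0 a< sa) (spectrum-dichotomy k b b≢0 b< sb)
        (spectrum-dichotomy k c c≢0 c< sc)
  where
  acb : ∀ a b c → a + c + b ≡ a + b + c
  acb = solve-∀
  bca : ∀ a b c → b + c + a ≡ a + b + c
  bca = solve-∀
  P : ℕ
  P = 2 ^ k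
  Goal : ℕ → Set
  Goal n = ∃[ m ] n + 2 ^ m ≡ 2 ^ suc (suc k)
  -- By the triangle inequality a norm is at most half of the total, which is below 2^(k+2). This
  -- brings all three into the range where their spectra say something.
  a< : a < 2 ^ suc k
  a< = triangle⇒<half a b c _ a≤ lt
  b< : b < 2 ^ suc k
  b< = triangle⇒<half b c a _ b≤ (subst (_< 2 ^ suc (suc k)) (sym (bca a b c)) lt)
  c< : c < 2 ^ suc k
  c< = triangle⇒<half c a b _ c≤ (subst (_< 2 ^ suc (suc k)) (bca c a b) lt)
  P≤a : P ≤ a
  P≤a = 2^≤nonzero-spectrum k a a≢0 sa
  P≤b : P ≤ b
  P≤b = 2^≤nonzero-spectrum k b b≢0 sb
  P≤c : P ≤ c
  P≤c = 2^≤nonzero-spectrum k c c≢0 sc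
  Class : ℕ → Set
  Class n = n ≡ P ⊎ 3 * P ≤ 2 * n
  cases : Class a → Class b → Class c → Goal (a + b + c)
  cases (inj₁ a≡) (inj₁ b≡) _ = spectrum-two-minimal k a b c a≡ b≡ c< sc
  cases (inj₁ a≡) (inj₂ _) (inj₁ c≡) =
    subst Goal (acb a b c) (spectrum-two-minimal k a c b a≡ c≡ b< sb)
  cases (inj₂ _) (inj₁ b≡) (inj₁ c≡) =
    subst Goal (bca a b c) (spectrum-two-minimal k b c a b≡ c≡ a< sa)
  cases (inj₂ a≥) (inj₂ b≥) _ = contradiction (two-nonminimal-≤ P a b c a≥ b≥ P≤c) (<⇒≱ lt)
  cases (inj₂ a≥) (inj₁ _) (inj₂ c≥) =
    contradiction (subst (2 ^ suc (suc k) ≤_) (acb a b c) (two-nonminimal-≤ P a c b a≥ c≥ P≤b)) (<⇒≱ lt)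
  cases (inj₁ _) (inj₂ b≥) (inj₂ c≥) =
    contradiction (subst (2 ^ suc (suc k) ≤_) (bca a b c) (two-nonminimal-≤ P b c a b≥ c≥ P≤a)) (<⇒≱ lt)

spectrum-layers : ∀ k (fs : List (Tuple v k → ℤ)) →
  All (λ f → Spectrum k (norm f) × norm f ≢ 0) fs → (∀ x → listSum fs x ≡ 0ℤ) →
  Spectrum (suc k) (ListAction.sum (map norm fs))
-- The norm 0 is 2^(k+2) - 2^(k+2).
spectrum-layers k [] _ _ _ = suc (suc k) , refl
spectrum-layers k (f ∷ []) ((_ , ≢0) ∷ []) zs _ = contradiction (total-zero _ f≡0) ≢0
  where
  f≡0 : ∀ x → ∣ f x ∣ ≡ 0
  f≡0 x = cong ∣_∣ (trans (sym (ℤ.+-identityʳ (f x))) (zs x))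
spectrum-layers k (f ∷ g ∷ []) ((sf , _) ∷ _) zs =
  subst (λ n → Spectrum (suc k) (norm f + (n + 0))) f≡g double
  where
  f≡g : norm f ≡ norm g
  f≡g = norm-opposite f g λ x →
    trans (cong (ℤ._+_ (f x)) (sym (ℤ.+-identityʳ (g x)))) (zs x)
  double : Spectrum (suc k) (2 * norm f)
  -- Doubling the equation for one layer raises the exponent by one.
  double lt with m , eq ← sf (*-cancelˡ-< 2 _ _ lt) =
    suc m , trans (sym (*-distribˡ-+ 2 (norm f) (2 ^ m))) (cong (2 *_) eq)
spectrum-layers k (f ∷ g ∷ h ∷ []) ((sf , f≢0) ∷ (sg , g≢0) ∷ (sh , h≢0) ∷ []) zs =
  subst (Spectrum (suc k)) (assoc (norm f) (norm g) (norm h))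
    (spectrum-three k _ _ _ f≢0 g≢0 h≢0 sf sg sh
      (norm-triangle f g h λ x → trans (fgh (f x) (g x) (h x)) (zs x))
      (norm-triangle g h f λ x → trans (ghf (f x) (g x) (h x)) (zs x))
      (norm-triangle h f g λ x → trans (hfg (f x) (g x) (h x)) (zs x)))
  where
  assoc : ∀ a b c → a + b + c ≡ a + (b + (c + 0))
  assoc = solve-∀
  fgh : ∀ i j l → i ℤ.+ (j ℤ.+ l) ≡ i ℤ.+ (j ℤ.+ (l ℤ.+ 0ℤ))
  fgh = ℤ-Solver.solve-∀
  ghf : ∀ i j l → j ℤ.+ (l ℤ.+ i) ≡ i ℤ.+ (j ℤ.+ (l ℤ.+ 0ℤ))
  ghf = ℤ-Solver.solve-∀
  hfg : ∀ i j l → l ℤ.+ (i ℤ.+ j) ≡ i ℤ.+ (j ℤ.+ (l ℤ.+ 0ℤ))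
  hfg = ℤ-Solver.solve-∀
-- Four nonzero layers, each of norm at least 2^k, already reach 2^(k+2).
spectrum-layers k (e ∷ f ∷ g ∷ h ∷ fs) ((se , e≢0) ∷ (sf , f≢0) ∷ (sg , g≢0) ∷ (sh , h≢0) ∷ _) _ lt =
  contradiction four (<⇒≱ lt)
  where
  open ≤-Reasoning
  expand : ∀ p → 2 * (2 * p) ≡ p + (p + (p + (p + 0)))
  expand = solve-∀
  four : 2 ^ suc (suc k) ≤ ListAction.sum (map norm (e ∷ f ∷ g ∷ h ∷ fs))
  four = begin
    2 ^ suc (suc k)                              ≡⟨ expand (2 ^ k) ⟩
    2 ^ k + (2 ^ k + (2 ^ k + (2 ^ k + 0)))      ≤⟨ +-mono-≤ (2^≤nonzero-spectrum k _ e≢0 se)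
                                                    (+-mono-≤ (2^≤nonzero-spectrum k _ f≢0 sf)
                                                    (+-mono-≤ (2^≤nonzero-spectrum k _ g≢0 sg)
                                                    (+-mono-≤ (2^≤nonzero-spectrum k _ h≢0 sh) z≤n))) ⟩
    ListAction.sum (map norm (e ∷ f ∷ g ∷ h ∷ fs))     ∎

norm-spectrum : ∀ k (f : Tuple v k → ℤ) → ZeroLineSums f → Spectrum k (norm f)
norm-spectrum zero f _ lt with norm f
-- For k = 0 the function is a single integer, and the values below 2 are 0 = 2 - 2^1 and 1 = 2 -
-- 2^0.
... | 0 = 1 , refl
... | 1 = 0 , refl
norm-spectrum zero f _ (s≤s (s≤s ())) | suc (suc _)
norm-spectrum (suc k) f z
  with fs , all , sums , norms ← nonzero-layers (λ g → Spectrum k (norm g)) (λ a x → f (a ∷ x))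
         (λ a → norm-spectrum k _ (ZeroLineSums-layer f z a))
  = subst (Spectrum (suc k)) (sym norms)
      -- Lines in direction `zero` run across the layers, so their vanishing sums say that the
      -- layers add up to zero pointwise.
      (spectrum-layers k fs all λ x → trans (sym (sums x)) (z zero x))

-- From trades to functions

indicator : ∀ {p} {P : Set p} → Dec P → ℕ
indicator P? = if does P? then 1 else 0

indicator-yes : ∀ {p} {P : Set p} (P? : Dec P) → P → indicator P? ≡ 1
indicator-yes P? p = cong (if_then 1 else 0) (dec-true P? p)

indicator-no : ∀ {p} {P : Set p} (P? : Dec P) → ¬ P → indicator P? ≡ 0
indicator-no P? ¬p = cong (if_then 1 else 0) (dec-false P? ¬p)

length-filter-∷ : ∀ {A : Set} {P : A → Set} (P? : Decidable P) y ys →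
  length (filter P? (y ∷ ys)) ≡ indicator (P? y) + length (filter P? ys)
length-filter-∷ P? y ys with P? y
... | yes _ = refl
... | no  _ = refl

_≟ᵀ_ : (x y : Tuple v k) → Dec (x ≡ y)
_≟ᵀ_ = ≡-dec Fin._≟_

multiplicity : List (Tuple v k) → Tuple v k → ℕ
multiplicity []       x = 0
multiplicity (y ∷ ys) x = indicator (x ≟ᵀ y) + multiplicity ys x

multiplicity≢0⇒∈ : (T : List (Tuple v k)) (x : Tuple v k) → multiplicity T x ≢ 0 → x ∈ T
multiplicity≢0⇒∈ []      x ≢0 = contradiction refl ≢0
multiplicity≢0⇒∈ (y ∷ T) x ≢0 with x ≟ᵀ y
... | yes x≡y = here x≡y
... | no  _   = there (multiplicity≢0⇒∈ T x ≢0)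

total-multiplicity : (T : List (Tuple v k)) → total (multiplicity T) ≡ length T
total-multiplicity {k = k} []      = total-zero {k = k} (multiplicity []) λ _ → refl
total-multiplicity         (y ∷ T) = begin
  total (multiplicity (y ∷ T))                               ≡⟨ total-+ (λ x → indicator (x ≟ᵀ y)) (multiplicity T) ⟩
  total (λ x → indicator (x ≟ᵀ y)) + total (multiplicity T)  ≡⟨ cong₂ _+_ single (total-multiplicity T) ⟩
  suc (length T)                                             ∎
  where
  open ≡-Reasoning
  single : total (λ x → indicator (x ≟ᵀ y)) ≡ 1
  single = trans (total-single _ y λ x x≢y → indicator-no (x ≟ᵀ y) x≢y) (indicator-yes (y ≟ᵀ y) refl)

-- A t-subset of t+1 positions misses exactly one position `d`, and the tuples containing `u` on the
-- others form a line in direction `d`. This turns the balance condition of a trade into a statement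
-- about line sums.
omit : Fin (suc t) → Positions t (suc t)
omit d .position       = punchIn d
omit d .increasing a<b =
  Fin.≤∧≢⇒< (Fin.punchIn-mono-≤ d _ _ (<⇒≤ a<b))
            (Fin.<⇒≢ a<b ∘ Fin.punchIn-injective d _ _)

contains-insertAt : ∀ (d : Fin (suc t)) (u : Tuple v t) a → Contains (omit d) u (insertAt u d a)
contains-insertAt d u a = insertAt-punchIn u d a

-- At `d` the inserted value is the entry of `y`. Any other position is `punchIn d` of some index,
-- where the containment hypothesis applies.
contains⇒insertAt : ∀ (d : Fin (suc t)) (u : Tuple v t) y → Contains (omit d) u y →
                    insertAt u d (lookup y d) ≡ y
contains⇒insertAt d u y c = lookup-injective λ j → pointwise j (d Fin.≟ j)
  where
  lookup-injective : ∀ {v n} {xs ys : Tuple v n} → (∀ j → lookup xs j ≡ lookup ys j) → xs ≡ ys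
  lookup-injective {xs = xs} {ys} eq =
    trans (sym (tabulate∘lookup xs)) (trans (tabulate-cong eq) (tabulate∘lookup ys))
  pointwise : ∀ j → Dec (d ≡ j) → lookup (insertAt u d (lookup y d)) j ≡ lookup y j
  pointwise j (yes refl) = insertAt-lookup u d _
  pointwise j (no d≢j)   = subst (λ l → lookup (insertAt u d (lookup y d)) l ≡ lookup y l)
    (Fin.punchIn-punchOut d≢j) (trans (insertAt-punchIn u d _ _) (sym (c (Fin.punchOut d≢j))))

-- A line meets `y` at most once, namely at the parameter `lookup y d`, and it does so exactly when
-- `y` contains `u` away from `d`.
sum-line-indicator : ∀ (d : Fin (suc t)) (u : Tuple v t) y →
  ℕΣ.sum (λ a → indicator (insertAt u d a ≟ᵀ y)) ≡ indicator (contains? (omit d) u y)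
-- Generalising over the decision lets the right-hand `indicator` compute to 1 or 0 in each case.
sum-line-indicator d u y = by-cases (contains? (omit d) u y)
  where
  by-cases : (c? : Dec (Contains (omit d) u y)) →
             ℕΣ.sum (λ a → indicator (insertAt u d a ≟ᵀ y)) ≡ indicator c?
  by-cases (yes c) = trans
    (sum-single _ (lookup y d) λ a a≢ → indicator-no (insertAt u d a ≟ᵀ y) λ eq →
      a≢ (trans (sym (insertAt-lookup u d a)) (cong (λ x → lookup x d) eq)))
    (indicator-yes (insertAt u d (lookup y d) ≟ᵀ y) (contains⇒insertAt d u y c))
  by-cases (no ¬c) = sum-zero _ λ a → indicator-no (insertAt u d a ≟ᵀ y) λ eq →
    ¬c (subst (Contains (omit d) u) eq (contains-insertAt d u a))

sum-line-multiplicity : ∀ (d : Fin (suc t)) (u : Tuple v t) T →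
  ℕΣ.sum (λ a → multiplicity T (insertAt u d a)) ≡ countContaining (omit d) u T
sum-line-multiplicity d u []      =
  sum-zero (λ a → multiplicity [] (insertAt u d a)) λ _ → refl
sum-line-multiplicity d u (y ∷ T) = begin
  ℕΣ.sum (λ a → multiplicity (y ∷ T) (insertAt u d a))
    ≡⟨ ℕΣ.∑-distrib-+ (λ a → indicator (insertAt u d a ≟ᵀ y)) _ ⟩
  ℕΣ.sum (λ a → indicator (insertAt u d a ≟ᵀ y)) + ℕΣ.sum (λ a → multiplicity T (insertAt u d a))
    ≡⟨ cong₂ _+_ (sum-line-indicator d u y) (sum-line-multiplicity d u T) ⟩
  indicator (contains? (omit d) u y) + countContaining (omit d) u T
    ≡⟨ length-filter-∷ (contains? (omit d) u) y T ⟨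
  countContaining (omit d) u (y ∷ T)
    ∎
  where open ≡-Reasoning

-- One of the two numbers is 0, so nothing cancels. Disjointness of the trade enters here and makes
-- the norm count all the tuples of both collections.
∣⊖∣-disjoint : ∀ m n → ¬ (m ≢ 0 × n ≢ 0) → ∣ m ⊖ n ∣ ≡ m + n
∣⊖∣-disjoint zero    zero    _ = refl
∣⊖∣-disjoint zero    (suc n) _ = refl
∣⊖∣-disjoint (suc m) zero    _ = sym (+-identityʳ _)
∣⊖∣-disjoint (suc m) (suc n) d = contradiction ((λ ()) , (λ ())) d

trade-spectrum : ∀ {s} → LatinTrade t (suc t) v s → Spectrum (suc t) (2 * s)
trade-spectrum {t} {v} {s} trade = subst (Spectrum (suc t)) norm≡2s (norm-spectrum (suc t) f zeroLineSums)
  where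
  open LatinTrade trade
  f : Tuple v (suc t) → ℤ
  f x = multiplicity T₁ x ⊖ multiplicity T₂ x
  zeroLineSums : ZeroLineSums f
  zeroLineSums d u = begin
    ℤΣ.sum (λ a → f (insertAt u d a))                                    ≡⟨ sum-⊖ (multiplicity T₁ ∘ insertAt u d) (multiplicity T₂ ∘ insertAt u d) ⟩
    ℕΣ.sum (multiplicity T₁ ∘ insertAt u d) ⊖ ℕΣ.sum (multiplicity T₂ ∘ insertAt u d)
      ≡⟨ cong₂ _⊖_ (sum-line-multiplicity d u T₁) (sum-line-multiplicity d u T₂) ⟩
    countContaining (omit d) u T₁ ⊖ countContaining (omit d) u T₂        ≡⟨ cong (_⊖ countContaining (omit d) u T₂) (balanced (omit d) u) ⟩
    countContaining (omit d) u T₂ ⊖ countContaining (omit d) u T₂        ≡⟨ ℤ.n⊖n≡0 (countContaining (omit d) u T₂) ⟩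
    0ℤ                                                                   ∎
    where open ≡-Reasoning
  norm≡2s : norm f ≡ 2 * s
  norm≡2s = begin
    norm f
      ≡⟨ total-cong (λ x → ∣⊖∣-disjoint (multiplicity T₁ x) (multiplicity T₂ x) λ (p , q) →
           disjoint (multiplicity≢0⇒∈ T₁ x p , multiplicity≢0⇒∈ T₂ x q)) ⟩
    total (λ x → multiplicity T₁ x + multiplicity T₂ x)   ≡⟨ total-+ (multiplicity T₁) (multiplicity T₂) ⟩
    total (multiplicity T₁) + total (multiplicity T₂)     ≡⟨ cong₂ _+_ (total-multiplicity T₁) (total-multiplicity T₂) ⟩
    length T₁ + length T₂                                 ≡⟨ cong₂ _+_ volume₁ volume₂ ⟩
    s + s                                                 ≡⟨ cong (s +_) (+-identityʳ s) ⟨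
    2 * s                                                 ∎
    where open ≡-Reasoning

-- With j = t − i, the two bounds on s say 2^(j+1) < 2^m < 2^(j+2).
spectrum-gap : ∀ k j s → j < k → 2 ^ k ∸ 2 ^ suc j < s → s < 2 ^ k ∸ 2 ^ j → ¬ Spectrum k (2 * s)
spectrum-gap k j s j<k lower upper spec = <⇒≱ m<2+j 2+j≤m
  where
  open ≤-Reasoning
  s+2^j<2^k : s + 2 ^ j < 2 ^ k
  s+2^j<2^k = m≤o∸n⇒m+n≤o (suc s) (^-monoʳ-≤ 2 (<⇒≤ j<k)) upper
  2^k<s+2^[1+j] : 2 ^ k < s + 2 ^ suc j
  2^k<s+2^[1+j] = begin-strict
    2 ^ k                                ≤⟨ m≤n+m∸n (2 ^ k) (2 ^ suc j) ⟩
    2 ^ suc j + (2 ^ k ∸ 2 ^ suc j)      <⟨ +-monoʳ-< (2 ^ suc j) lower ⟩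
    2 ^ suc j + s                        ≡⟨ +-comm (2 ^ suc j) s ⟩
    s + 2 ^ suc j                        ∎
  solution : ∃[ m ] 2 * s + 2 ^ m ≡ 2 ^ suc k
  -- Since s < 2^k, the norm 2s lies below the threshold 2^(k+1).
  solution = spec (*-monoʳ-< 2 (≤-<-trans (m≤m+n s (2 ^ j)) s+2^j<2^k))
  m : ℕ
  m = proj₁ solution
  m<2+j : m < suc (suc j)
  m<2+j = 2^-cancel-< m (suc (suc j)) (+-cancelˡ-< (2 * s) _ _ (begin-strict
    2 * s + 2 ^ m              ≡⟨ proj₂ solution ⟩
    2 * 2 ^ k                  <⟨ *-monoʳ-< 2 2^k<s+2^[1+j] ⟩
    2 * (s + 2 ^ suc j)        ≡⟨ *-distribˡ-+ 2 s (2 ^ suc j) ⟩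
    2 * s + 2 ^ suc (suc j)    ∎))
  2+j≤m : suc (suc j) ≤ m
  2+j≤m = 2^-cancel-< (suc j) m (+-cancelˡ-< (2 * s) _ _ (begin-strict
    2 * s + 2 ^ suc j      ≡⟨ *-distribˡ-+ 2 s (2 ^ j) ⟨
    2 * (s + 2 ^ j)        <⟨ *-monoʳ-< 2 s+2^j<2^k ⟩
    2 * 2 ^ k              ≡⟨ proj₂ solution ⟨
    2 * s + 2 ^ m          ∎))

theorem3 : (t i : ℕ) → 1 ≤ t → 1 ≤ i → i ≤ t →
    (s : ℕ) →
    2 ^ (t + 1) ∸ 2 ^ ((t + 1) ∸ i) < s →
    s < 2 ^ (t + 1) ∸ 2 ^ ((t + 1) ∸ (i + 1)) →
    (v : ℕ) → 1 ≤ v → ¬ LatinTrade t (t + 1) v s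
theorem3 t i 1≤t 1≤i i≤t s lower upper v 1≤v trade
  -- After rewriting, `(t + 1) ∸ i` becomes `suc (t ∸ i)`, and `(t + 1) ∸ (i + 1)` reduces to
  -- `t ∸ i`, which are the exponents j+1 and j for j = t - i.
  rewrite +-comm t 1 | +-comm i 1 | +-∸-assoc 1 i≤t =
  spectrum-gap (suc t) (t ∸ i) s (s≤s (m∸n≤m t i)) lower upper (trade-spectrum trade)
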